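{- Suppose a biclique $[A,B]$ is partitioned into $r$ bi-equivalence graphs and no two vertices of $A$ are equivalent. Then $\max\{|A|,|B|\}\le r!$, and equality is possible.
   Context: A biclique $[A,B]$ is a complete bipartite graph with nonempty vertex classes $A$ and $B$. A bi-equivalence graph is a graph each of whose connected components is a biclique (with both vertex classes nonempty); the two vertex classes of a component are called its blocks. A partition of $[A,B]$ into bi-equivalence graphs $G_1,\dots,G_r$ means that every edge of $[A,B]$ belongs to exactly one $G_i$; a vertex need not be incident with an edge of every $G_i$. Two vertices $u,v$ in the same class ($u,v\in A$ or $u,v\in B$) are equivalent if they belong to the same block in every bi-equivalence graph of the partition, in the sense that for every vertex $w$ of the opposite class the edges $uw$ and $vw$ belong to the same $G_i$ (so for each $i$, either $u$ and $v$ lie in the same block of $G_i$ or neither is incident with an edge of $G_i$).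
   Formalization: The bound on max{|A|,|B|} also assumes that no two vertices of B are equivalent (it fails for a star with r = 1, |A| = 1, |B| = 2); |A| ≤ r! is proved under the stated hypothesis on A alone; graphs are finite and equality is shown for every r ≥ 1. -}

module Defs where

open import Data.Empty using (⊥)
open import Data.Fin using (Fin)
open import Data.Nat using (ℕ)
open import Data.Product using (_×_; _,_; ∃-syntax; ∃!)
open import Data.Sum using (_⊎_; inj₁; inj₂)
open import Data.Unit using (⊤; tt)
open import Function.Bundles using (_⇔_)
open import Relation.Binary.Construct.Closure.ReflexiveTransitive using (Star)
open import Relation.Binary.PropositionalEquality using (_≡_; _≢_)
open import Relation.Nullary using (¬_)
open import Relation.Unary using (Pred; _∈_; Satisfiable; _⊆_)
open import Level using (0ℓ)

-- The vertex set is a subset of the ambient type V.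
record Graph (V : Set) : Set₁ where
  field
    Vert   : Pred V 0ℓ
    Adj    : V → V → Set
    sym    : ∀ {u v} → Adj u v → Adj v u
    irrefl : ∀ {u} → ¬ Adj u u
    ends   : ∀ {u v} → Adj u v → u ∈ Vert

open Graph public using (Vert; Adj)

module _ {V : Set} where

  induced : Graph V → Pred V 0ℓ → Graph V
  induced G S = record
    { Vert   = λ u → u ∈ S × u ∈ Vert G
    ; Adj    = λ u v → u ∈ S × v ∈ S × Adj G u v
    ; sym    = λ (su , sv , e) → sv , su , Graph.sym G e
    ; irrefl = λ (_ , _ , e) → Graph.irrefl G e
    ; ends   = λ (su , _ , e) → su , Graph.ends G e
    }

  component : Graph V → V → Graph V
  component G v = induced G (Star (Adj G) v)

  record IsBicliqueWith (G : Graph V) (P Q : Pred V 0ℓ) : Set where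
    field
      nonempty₁ : Satisfiable P
      nonempty₂ : Satisfiable Q
      disjoint  : ∀ {u} → u ∈ P → ¬ (u ∈ Q)
      vertices  : ∀ u → u ∈ Vert G ⇔ (u ∈ P ⊎ u ∈ Q)
      edges     : ∀ u v → Adj G u v ⇔ ((u ∈ P × v ∈ Q) ⊎ (u ∈ Q × v ∈ P))

  IsBiclique : Graph V → Set₁
  IsBiclique G = ∃[ P ] ∃[ Q ] IsBicliqueWith G P Q

  IsBiEquivalence : Graph V → Set₁
  IsBiEquivalence G = ∀ v → v ∈ Vert G → IsBiclique (component G v)

  record _IsSubgraphOf_ (G H : Graph V) : Set where
    field
      vert⊆ : Vert G ⊆ Vert H
      adj⊆  : ∀ {u v} → Adj G u v → Adj H u v

-- The biclique [A,B] with A = Fin m and B = Fin n; nonemptiness of the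
-- classes (m, n ≠ 0) is not imposed here.
[Fin_,Fin_] : ∀ m n → Graph (Fin m ⊎ Fin n)
[Fin m ,Fin n ] = record
  { Vert   = λ _ → ⊤
  ; Adj    = K
  ; sym    = λ {u} {v} → K-sym u v
  ; irrefl = λ {u} → K-irrefl u
  ; ends   = λ _ → tt
  }
  where
  K : Fin m ⊎ Fin n → Fin m ⊎ Fin n → Set
  K (inj₁ _) (inj₂ _) = ⊤
  K (inj₂ _) (inj₁ _) = ⊤
  K _        _        = ⊥

  K-sym : ∀ u v → K u v → K v u
  K-sym (inj₁ _) (inj₂ _) _ = tt
  K-sym (inj₂ _) (inj₁ _) _ = tt

  K-irrefl : ∀ u → ¬ K u u
  K-irrefl (inj₁ _) ()
  K-irrefl (inj₂ _) ()

record BiEquivalencePartition (m n r : ℕ) : Set₁ where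
  field
    part          : Fin r → Graph (Fin m ⊎ Fin n)
    subgraph      : ∀ i → part i IsSubgraphOf [Fin m ,Fin n ]
    biEquivalence : ∀ i → IsBiEquivalence (part i)
    exactlyOne    : ∀ {u v} → Adj [Fin m ,Fin n ] u v →
                    ∃! _≡_ (λ i → Adj (part i) u v)

data SameClass {m n : ℕ} : Fin m ⊎ Fin n → Fin m ⊎ Fin n → Set where
  bothA : ∀ {a a′} → SameClass (inj₁ a) (inj₁ a′)
  bothB : ∀ {b b′} → SameClass (inj₂ b) (inj₂ b′)

module _ {m n r : ℕ} (𝒢 : BiEquivalencePartition m n r) where
  open BiEquivalencePartition 𝒢

  -- Since u and v lie in the same class, the neighbours w of u in [A,B] are
  -- exactly the vertices of the class opposite to both.
  Equivalent : Fin m ⊎ Fin n → Fin m ⊎ Fin n → Set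
  Equivalent u v = SameClass u v ×
    (∀ w → Adj [Fin m ,Fin n ] u w →
       ∃[ i ] (Adj (part i) u w × Adj (part i) v w))

  -- NoTwoEquivalentA alone does not bound n: for r = 1 a star [A,B] with
  -- |A| = 1 is itself a bi-equivalence graph, NoTwoEquivalentA holds
  -- vacuously, and |B| is arbitrary.  A bound on max{|A|,|B|} therefore needs
  -- NoTwoEquivalentB as well; a bound on |A| does not.
  NoTwoEquivalentA : Set
  NoTwoEquivalentA = ∀ a a′ → a ≢ a′ → ¬ Equivalent (inj₁ a) (inj₁ a′)

  NoTwoEquivalentB : Set
  NoTwoEquivalentB = ∀ b b′ → b ≢ b′ → ¬ Equivalent (inj₂ b) (inj₂ b′)

{-# OPTIONS --safe #-}
-- A partition is a colouring c of A × B in which every colour class is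
-- difunctional (three edges of a 4-cycle force the fourth).  For the bound, fix
-- a column b and split the rows by their colour in b.  Inside the class of
-- colour i every other column is, by difunctionality, entirely of colour i or
-- free of i, so that only r - 1 colours distinguish the rows of the class;
-- induction gives r · (r - 1)! rows.  For equality take as rows all
-- permutations σ of the colours, as columns the positions p, and c σ p = σ(p).
module Submission where

open import Data.Empty using (⊥; ⊥-elim)
open import Data.Fin using (Fin; zero; suc; combine; remQuot; punchIn; punchOut; fromℕ<)
open import Data.Fin.Properties
  using (_≟_; any?; combine-injective; combine-remQuot; injective⇒≤; punchIn-injective;
         punchIn-punchOut; punchInᵢ≢i)
open import Data.Nat using (ℕ; zero; suc; NonZero; _≤_; _⊔_; _!; >-nonZero⁻¹)
open import Data.Nat.Properties using (_!≢0; ⊔-lub; m≤m⊔n; ≤-antisym)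
open import Data.Product
  using (_×_; _,_; proj₁; proj₂; Σ-syntax; ∃-syntax; ∃!)
open import Data.Sum using (_⊎_; inj₁; inj₂)
open import Data.Unit using (⊤; tt)
open import Function using (_∘_; id; flip)
open import Function.Bundles using (Equivalence; mk⇔)
open import Relation.Binary.Construct.Closure.ReflexiveTransitive
  using (Star; ε; _◅_; _◅◅_; reverse)
open import Relation.Binary.PropositionalEquality
  using (_≡_; _≢_; refl; sym; trans; cong)
open import Relation.Nullary using (¬_; yes; no)
open import Relation.Nullary.Decidable using (_×-dec_; decidable-stable)
open import Relation.Unary using (Pred; Decidable)
open import Level using (0ℓ)
open import Defs

-- Difunctional colourings of the edges of the biclique.

Colouring : ℕ → ℕ → ℕ → Set
Colouring m n r = Fin m → Fin n → Fin r

Difunctional : ∀ {m n r} → Colouring m n r → Set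
Difunctional c = ∀ {i a a′ b b′} → c a b ≡ i → c a′ b ≡ i → c a′ b′ ≡ i → c a b′ ≡ i

RowsDistinct : ∀ {m n r} → Colouring m n r → Set
RowsDistinct c = ∀ {a a′} → (∀ b → c a b ≡ c a′ b) → a ≡ a′

flip-difunctional : ∀ {m n r} (c : Colouring m n r) → Difunctional c → Difunctional (flip c)
flip-difunctional c d p q s = d s q p

all⊎any : ∀ {n} {P Q : Pred (Fin n) 0ℓ} → (∀ i → P i ⊎ Q i) → (∀ i → P i) ⊎ (∃[ i ] Q i)
all⊎any {zero}  f = inj₁ λ ()
all⊎any {suc n} f with f zero | all⊎any (f ∘ suc)
... | inj₂ q | _            = inj₂ (zero , q)
... | inj₁ _ | inj₂ (i , q) = inj₂ (suc i , q)
... | inj₁ p | inj₁ ps      = inj₁ λ { zero → p ; (suc i) → ps i }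

-- The factorial bound on distinct rows.

module _ {m n r} (c : Colouring m n r) (d : Difunctional c) (distinct : RowsDistinct c) where

  ConstantOn : Pred (Fin m) 0ℓ → Fin n → Set
  ConstantOn P b = ∀ {a a′} → P a → P a′ → c a b ≡ c a′ b

  -- Here `s` is the palette of colours still available on the class `P`.
  UsesOnly : ∀ {k} → (Fin k → Fin r) → Pred (Fin m) 0ℓ → Fin n → Set
  UsesOnly s P b = ∀ {a} → P a → ∃[ j ] c a b ≡ s j

  -- Bounds the size of `P`. The code may depend on the membership proof, but must determine the
  -- row.
  Code : Pred (Fin m) 0ℓ → ℕ → Set
  Code P k = Σ[ f ∈ (∀ {a} → P a → Fin k) ] (∀ {a a′} (p : P a) (p′ : P a′) → f p ≡ f p′ → a ≡ a′)

  -- The witness `a₀` decides the role of colour `s i` in column `b`. If `a₀` has it there,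
  -- difunctionality through `b₀` spreads it to the whole class; if a row of the class had it there,
  -- so would `a₀`.
  refine : ∀ {k P b₀} (s : Fin (suc k) → Fin r) i →
           ∃[ a ] (P a × c a b₀ ≡ s i) →
           (∀ b → ConstantOn P b ⊎ UsesOnly s P b) →
           ∀ b → ConstantOn (λ a → P a × c a b₀ ≡ s i) b ⊎
                 UsesOnly (s ∘ punchIn i) (λ a → P a × c a b₀ ≡ s i) b
  refine s i (a₀ , _ , e₀) h b with h b
  ... | inj₁ const = inj₁ λ (p , _) (p′ , _) → const p p′
  ... | inj₂ uses with c a₀ b ≟ s i
  ...   | yes hit = inj₁ λ (_ , e) (_ , e′) → trans (d e e₀ hit) (sym (d e′ e₀ hit))
  ...   | no miss = inj₂ avoid
    where
    avoid : UsesOnly (s ∘ punchIn i) _ b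
    avoid (p , e) with uses p
    ... | j , eq = punchOut i≢j , trans eq (cong s (sym (punchIn-punchOut i≢j)))
      where
      i≢j : i ≢ j
      i≢j refl = miss (d e₀ e eq)

  -- A constant column separates no rows of `P`, so it may show a colour outside the palette; only
  -- the other columns must respect `s`.
  encode : ∀ k {P} → Decidable P → (s : Fin k → Fin r) →
           (∀ b → ConstantOn P b ⊎ UsesOnly s P b) → Code P (k !)
  encode k P? s h with all⊎any h
  -- No column separates rows of `P`, so `P` has at most one row and the code 0 serves, which exists
  -- as `k !` is positive.
  ... | inj₁ const = (λ _ → fromℕ< (>-nonZero⁻¹ (k !) {{k !≢0}})) ,
                     λ p p′ _ → distinct λ b → const b p p′
  encode zero P? s h | inj₂ (b₀ , uses) =
    (λ p → ⊥-elim (noColour p)) , λ p _ _ → ⊥-elim (noColour p)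
    where
    noColour : ∀ {a} → _ → ⊥
    noColour {a} p with uses {a} p
    ... | () , _
  encode (suc k) {P} P? s h | inj₂ (b₀ , uses) =
    -- The code pairs the colour index in `b₀` with a code inside that colour's class, which fills
    -- `suc k` times `k !` values.
    (λ p → combine (proj₁ (uses p)) (proj₁ (code (proj₁ (uses p))) (p , proj₂ (uses p)))) ,
    λ p p′ → inj _ _ (p , proj₂ (uses p)) (p′ , proj₂ (uses p′))
    where
    code : ∀ i → Code (λ a → P a × c a b₀ ≡ s i) (k !)
    -- `refine` needs a row of the class, so an empty class is split off; this is where decidability
    -- of `P` enters.
    code i with any? (λ a → P? a ×-dec (c a b₀ ≟ s i))
    ... | yes w = encode k (λ a → P? a ×-dec (c a b₀ ≟ s i)) (s ∘ punchIn i) (refine s i w h)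
    ... | no ¬w = (λ {a} q → ⊥-elim (¬w (a , q))) , λ {a} q _ _ → ⊥-elim (¬w (a , q))

    inj : ∀ {a a′} i i′ (q : P a × c a b₀ ≡ s i) (q′ : P a′ × c a′ b₀ ≡ s i′) →
          combine i (proj₁ (code i) q) ≡ combine i′ (proj₁ (code i′) q′) → a ≡ a′
    inj i i′ q q′ eq with combine-injective i _ i′ _ eq
    ... | refl , eq′ = proj₂ (code i) q q′ eq′

  rows≤! : m ≤ r !
  rows≤! = injective⇒≤ λ {a} {a′} → proj₂ code {a} {a′} tt tt
    where
    code : Code (λ _ → ⊤) (r !)
    code = encode r (λ _ → yes tt) id λ b → inj₂ λ {a} _ → c a b , refl

-- From a partition to a colouring.

module _ {m n r} (𝒢 : BiEquivalencePartition m n r) where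
  open BiEquivalencePartition 𝒢

  colour : Colouring m n r
  colour a b = proj₁ (exactlyOne {inj₁ a} {inj₂ b} tt)

  colour-adj : ∀ {i a b} → colour a b ≡ i → Adj (part i) (inj₁ a) (inj₂ b)
  colour-adj {a = a} {b} refl = proj₁ (proj₂ (exactlyOne {inj₁ a} {inj₂ b} tt))

  -- The three edges form a path, so they lie in one component. Its two classes alternate along the
  -- path, so the end vertices are in opposite classes and hence adjacent.
  colour-difunctional : Difunctional colour
  colour-difunctional {i} {a} {a′} {b} {b′} p q s =
    proj₂ (proj₂ (exactlyOne {inj₁ a} {inj₂ b′} tt)) closing
    where
    G = part i
    ab = colour-adj p
    a′b = colour-adj q
    a′b′ = colour-adj s
    b∈ : Star (Adj G) (inj₁ a) (inj₂ b)
    b∈ = ab ◅ ε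
    a′∈ : Star (Adj G) (inj₁ a) (inj₁ a′)
    a′∈ = b∈ ◅◅ Graph.sym G a′b ◅ ε
    b′∈ : Star (Adj G) (inj₁ a) (inj₂ b′)
    b′∈ = a′∈ ◅◅ a′b′ ◅ ε

    closing : Adj G (inj₁ a) (inj₂ b′)
    closing with biEquivalence i (inj₁ a) (Graph.ends G ab)
    ... | P , Q , K with Equivalence.to (IsBicliqueWith.edges K _ _) (ε , b∈ , ab)
                       | Equivalence.to (IsBicliqueWith.edges K _ _) (a′∈ , b∈ , a′b)
                       | Equivalence.to (IsBicliqueWith.edges K _ _) (a′∈ , b′∈ , a′b′)
    ...   | inj₁ (x , _) | inj₁ _ | inj₁ (_ , z) =
              proj₂ (proj₂ (Equivalence.from (IsBicliqueWith.edges K _ _) (inj₁ (x , z))))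
    ...   | inj₂ (x , _) | inj₂ _ | inj₂ (_ , z) =
              proj₂ (proj₂ (Equivalence.from (IsBicliqueWith.edges K _ _) (inj₂ (x , z))))
    -- Any other orientation puts `b` or `a′` into both classes.
    ...   | inj₁ (_ , y) | inj₂ (_ , y′) | _ = ⊥-elim (IsBicliqueWith.disjoint K y′ y)
    ...   | inj₂ (_ , y) | inj₁ (_ , y′) | _ = ⊥-elim (IsBicliqueWith.disjoint K y y′)
    ...   | _ | inj₁ (x , _) | inj₂ (x′ , _) = ⊥-elim (IsBicliqueWith.disjoint K x x′)
    ...   | _ | inj₂ (x , _) | inj₁ (x′ , _) = ⊥-elim (IsBicliqueWith.disjoint K x′ x)

  colour-rowsDistinct : NoTwoEquivalentA 𝒢 → RowsDistinct colour
  colour-rowsDistinct noEq {a} {a′} eq = decidable-stable (a ≟ a′) λ a≢a′ →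
    noEq a a′ a≢a′ (bothA , λ
      { (inj₂ b) _ → colour a b , colour-adj refl , colour-adj (sym (eq b)) })

  colour-columnsDistinct : NoTwoEquivalentB 𝒢 → RowsDistinct (flip colour)
  colour-columnsDistinct noEq {b} {b′} eq = decidable-stable (b ≟ b′) λ b≢b′ →
    noEq b b′ b≢b′ (bothB , λ
      { (inj₁ a) _ → colour a b , Graph.sym (part _) (colour-adj refl)
                                , Graph.sym (part _) (colour-adj (sym (eq a))) })

  |A|≤! : NoTwoEquivalentA 𝒢 → m ≤ r !
  |A|≤! = rows≤! colour colour-difunctional ∘ colour-rowsDistinct

  |B|≤! : NoTwoEquivalentB 𝒢 → n ≤ r !
  |B|≤! = rows≤! (flip colour) (flip-difunctional colour colour-difunctional) ∘ colour-columnsDistinct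

-- From a colouring to a partition.

module _ {m n r} (c : Colouring m n r) (d : Difunctional c) where

  private
    V = Fin m ⊎ Fin n

  Coloured : Fin r → V → V → Set
  Coloured i (inj₁ a) (inj₂ b) = c a b ≡ i
  Coloured i (inj₂ b) (inj₁ a) = c a b ≡ i
  Coloured _ _        _        = ⊥

  Coloured-sym : ∀ i u v → Coloured i u v → Coloured i v u
  Coloured-sym i (inj₁ _) (inj₂ _) e = e
  Coloured-sym i (inj₂ _) (inj₁ _) e = e

  Coloured-irrefl : ∀ i u → ¬ Coloured i u u
  Coloured-irrefl i (inj₁ _) ()
  Coloured-irrefl i (inj₂ _) ()

  -- Isolated vertices are left out, since their components would have an empty class.
  colourClass : Fin r → Graph V
  colourClass i = record
    { Vert   = λ u → ∃[ v ] Coloured i u v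
    ; Adj    = Coloured i
    ; sym    = λ {u} {v} → Coloured-sym i u v
    ; irrefl = λ {u} → Coloured-irrefl i u
    ; ends   = λ {u} {v} e → v , e
    }

  -- What connectedness in a colour class amounts to under difunctionality.
  Linked : Fin r → V → V → Set
  Linked i (inj₁ a) (inj₂ b)  = c a b ≡ i
  Linked i (inj₂ b) (inj₁ a)  = c a b ≡ i
  Linked i (inj₁ a) (inj₁ a′) = ∀ b → c a b ≡ i → c a′ b ≡ i
  Linked i (inj₂ b) (inj₂ b′) = ∀ a → c a b ≡ i → c a b′ ≡ i

  -- Induction on the path, removing its first edge. If the ends are on the same side, the rest of
  -- the path amounts to an edge and difunctionality applies; otherwise the rest carries the first
  -- edge over to the end vertex.
  connected⇒linked : ∀ i {u v} → Star (Coloured i) u v → Linked i u v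
  connected⇒linked i {inj₁ _} ε = λ _ e → e
  connected⇒linked i {inj₂ _} ε = λ _ e → e
  connected⇒linked i {inj₁ a} {inj₁ a′} (_◅_ {j = inj₂ b} e es) =
    λ _ → d (connected⇒linked i es) e
  connected⇒linked i {inj₁ a} {inj₂ b′} (_◅_ {j = inj₂ b} e es) =
    connected⇒linked i es a e
  connected⇒linked i {inj₂ b} {inj₂ b′} (_◅_ {j = inj₁ a} e es) =
    λ _ e′ → d e′ e (connected⇒linked i es)
  connected⇒linked i {inj₂ b} {inj₁ a′} (_◅_ {j = inj₁ a} e es) =
    connected⇒linked i es b e

  InA InB : Pred V 0ℓ
  InA (inj₁ _) = ⊤
  InA (inj₂ _) = ⊥
  InB (inj₁ _) = ⊥
  InB (inj₂ _) = ⊤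

  -- The classes are the parts of the component in A and in B. The edge at `v` makes both nonempty,
  -- and linked vertices on opposite sides are adjacent.
  colourClass-biEquivalence : ∀ i → IsBiEquivalence (colourClass i)
  colourClass-biEquivalence i v v∈@(w , vw) = P , Q , record
    { nonempty₁ = side₁ v w vw v∈H w∈H
    ; nonempty₂ = side₂ v w vw v∈H w∈H
    ; disjoint  = λ {u} → disj u
    ; vertices  = λ u → mk⇔ (split u) (λ { (inj₁ (_ , x)) → x ; (inj₂ (_ , x)) → x })
    ; edges     = λ u u′ → mk⇔ (to u u′) (from u u′)
    }
    where
    H = component (colourClass i) v
    P Q : Pred V 0ℓ
    P u = InA u × Vert H u
    Q u = InB u × Vert H u

    v∈H : Vert H v
    v∈H = ε , v∈
    w∈H : Vert H w
    w∈H = vw ◅ ε , v , Coloured-sym i v w vw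

    side₁ : ∀ x y → Coloured i x y → Vert H x → Vert H y → ∃[ u ] P u
    side₁ (inj₁ a) (inj₂ _) _ x _ = inj₁ a , tt , x
    side₁ (inj₂ _) (inj₁ a) _ _ y = inj₁ a , tt , y

    side₂ : ∀ x y → Coloured i x y → Vert H x → Vert H y → ∃[ u ] Q u
    side₂ (inj₁ _) (inj₂ b) _ _ y = inj₂ b , tt , y
    side₂ (inj₂ b) (inj₁ _) _ x _ = inj₂ b , tt , x

    disj : ∀ u → P u → ¬ Q u
    disj (inj₁ _) _ ()
    disj (inj₂ _) ()

    split : ∀ u → Vert H u → P u ⊎ Q u
    split (inj₁ _) x = inj₁ (tt , x)
    split (inj₂ _) x = inj₂ (tt , x)

    to : ∀ u u′ → Adj H u u′ → (P u × Q u′) ⊎ (Q u × P u′)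
    to (inj₁ a) (inj₂ b) (x , y , e) = inj₁ ((tt , x , inj₂ b , e) , (tt , y , inj₁ a , e))
    to (inj₂ b) (inj₁ a) (x , y , e) = inj₂ ((tt , x , inj₁ a , e) , (tt , y , inj₂ b , e))

    joined : ∀ {u u′} → Vert H u → Vert H u′ → Linked i u u′
    -- The path from `u` to `u′` runs through `v`.
    joined (x , _) (y , _) = connected⇒linked i (reverse (λ {u} {u′} → Coloured-sym i u u′) x ◅◅ y)

    from : ∀ u u′ → (P u × Q u′) ⊎ (Q u × P u′) → Adj H u u′
    from (inj₁ _) (inj₂ _) (inj₁ ((_ , x) , (_ , y))) = proj₁ x , proj₁ y , joined x y
    from (inj₂ _) (inj₁ _) (inj₂ ((_ , x) , (_ , y))) = proj₁ x , proj₁ y , joined x y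
    from (inj₁ _) (inj₁ _) (inj₁ (_ , () , _))
    from (inj₁ _) (inj₁ _) (inj₂ ((() , _) , _))
    from (inj₂ _) (inj₂ _) (inj₁ ((() , _) , _))
    from (inj₂ _) (inj₂ _) (inj₂ (_ , () , _))

  partition : BiEquivalencePartition m n r
  partition = record
    { part          = colourClass
    ; subgraph      = λ i → record { vert⊆ = λ _ → tt ; adj⊆ = λ {u} {v} → adj⊆ i u v }
    ; biEquivalence = colourClass-biEquivalence
    ; exactlyOne    = λ {u} {v} → unique u v
    }
    where
    adj⊆ : ∀ i u v → Coloured i u v → Adj [Fin m ,Fin n ] u v
    adj⊆ i (inj₁ _) (inj₂ _) _ = tt
    adj⊆ i (inj₂ _) (inj₁ _) _ = tt

    unique : ∀ u v → Adj [Fin m ,Fin n ] u v → ∃! _≡_ (λ i → Coloured i u v)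
    unique (inj₁ a) (inj₂ b) _ = c a b , refl , id
    unique (inj₂ b) (inj₁ a) _ = c a b , refl , id

  partition-noTwoEquivalentA : RowsDistinct c → NoTwoEquivalentA partition
  partition-noTwoEquivalentA distinct a a′ a≢a′ (_ , same) = a≢a′ (distinct λ b →
    let _ , e , e′ = same (inj₂ b) tt in trans e (sym e′))

  partition-noTwoEquivalentB : RowsDistinct (flip c) → NoTwoEquivalentB partition
  partition-noTwoEquivalentB distinct b b′ b≢b′ (_ , same) = b≢b′ (distinct λ a →
    let _ , e , e′ = same (inj₁ a) tt in trans e (sym e′))

-- The extremal colouring by permutations.

-- Lehmer code: the leading digit is the value at `zero`, and `punchIn` makes the permutation of the
-- rest skip that value.
permutation : ∀ r → Fin (r !) → Fin r → Fin r
permutation (suc k) x zero    = proj₁ (remQuot {suc k} (k !) x)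
permutation (suc k) x (suc p) =
  punchIn (proj₁ (remQuot {suc k} (k !) x)) (permutation k (proj₂ (remQuot {suc k} (k !) x)) p)

permutation-injective : ∀ r x {p q} → permutation r x p ≡ permutation r x q → p ≡ q
permutation-injective (suc k) x {zero}  {zero}  eq = refl
permutation-injective (suc k) x {zero}  {suc q} eq = ⊥-elim (punchInᵢ≢i _ _ (sym eq))
permutation-injective (suc k) x {suc p} {zero}  eq = ⊥-elim (punchInᵢ≢i _ _ eq)
permutation-injective (suc k) x {suc p} {suc q} eq =
  cong suc (permutation-injective k _ (punchIn-injective _ _ _ eq))

-- A row shows each colour at most once, so the two columns of the 4-cycle coincide.
permutation-difunctional : ∀ r → Difunctional (permutation r)
permutation-difunctional r {a′ = y} e e′ e″
  with refl ← permutation-injective r y (trans e′ (sym e″)) = e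

permutation-rowsDistinct : ∀ r → RowsDistinct (permutation r)
permutation-rowsDistinct zero    {zero} {zero} _ = refl
permutation-rowsDistinct (suc k) {x} {y} eq =
  trans (sym (combine-remQuot {suc k} (k !) x))
    (trans (glue _ _ _ _ (eq zero) (eq ∘ suc)) (combine-remQuot {suc k} (k !) y))
  where
  -- The digits are variables here so that matching on `refl` can identify the leading ones; then
  -- `punchIn q` cancels.
  glue : ∀ q q′ z z′ → q ≡ q′ →
         (∀ p → punchIn q (permutation k z p) ≡ punchIn q′ (permutation k z′ p)) →
         combine q z ≡ combine q′ z′
  glue q _ z z′ refl h =
    cong (combine q) (permutation-rowsDistinct k (punchIn-injective q _ _ ∘ h))

theorem2 : (∀ (r m n : ℕ) → NonZero m → NonZero n →
    (𝒢 : BiEquivalencePartition m n r) →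
    NoTwoEquivalentA 𝒢 →
    (m ≤ r !) × (NoTwoEquivalentB 𝒢 → m ⊔ n ≤ r !))
    ×
    (∀ (r : ℕ) → NonZero r →
    ∃[ m ] ∃[ n ] (NonZero m × NonZero n ×
    (Σ[ 𝒢 ∈ BiEquivalencePartition m n r ]
    (NoTwoEquivalentA 𝒢 × NoTwoEquivalentB 𝒢 × (m ⊔ n ≡ r !)))))
theorem2 =
  (λ r m n _ _ 𝒢 noA → |A|≤! 𝒢 noA , λ noB → ⊔-lub (|A|≤! 𝒢 noA) (|B|≤! 𝒢 noB)) ,
  λ r r≢0 →
    let 𝒢   = partition (permutation r) (permutation-difunctional r)
        noA = partition-noTwoEquivalentA _ (permutation-difunctional r) (permutation-rowsDistinct r)
        noB = partition-noTwoEquivalentB _ (permutation-difunctional r)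
                -- One permutation already separates all positions; the one with index 0 is taken.
                λ eq → permutation-injective r _ (eq (fromℕ< (>-nonZero⁻¹ (r !) {{r !≢0}})))
    in r ! , r , (r !≢0) , r≢0 , 𝒢 , noA , noB ,
       -- The upper bound is the first half applied to this very partition.
       ≤-antisym (⊔-lub (|A|≤! 𝒢 noA) (|B|≤! 𝒢 noB)) (m≤m⊔n (r !) r)
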